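{- Let $B=\left(\frac{e}{\sqrt{2\pi}}\right)^3$. For all integers $k\ge 1$, $$R(3,k)\le 2^{B(k-1)^{1/2}2^{2k}}.$$
   Context: For a set $X$ and an integer $a\ge 1$, $\binom{X}{a}$ denotes the set of all $a$-element subsets of $X$, and $[n]=\{1,\dots,n\}$. Given a coloring $COL$ of $\binom{[n]}{a}$, a set $H\subseteq[n]$ is $a$-homogeneous for $COL$ if all elements of $\binom{H}{a}$ have the same color (vacuously true if $|H|<a$). For integers $a,k\ge 1$, $R(a,k)$ denotes the least $n$ such that for every 2-coloring of $\binom{[n]}{a}$ there exists an $a$-homogeneous set $H\subseteq [n]$ with $|H|=k$ (this number exists by Ramsey's theorem). -}

module Defs where

open import Algebra.Definitions.RawSemiring using (_^_)
open import Data.Fin.Base using (Fin)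
open import Data.Fin.Subset using (Subset; _⊆_; ∣_∣)
open import Data.Integer.Base as ℤ using (ℤ; +_; -[1+_]; -1ℤ)
open import Data.Nat.Base as ℕ using (ℕ; zero; suc; _!)
open import Data.Nat.Properties using (_!≢0)
open import Data.Product.Base using (_×_; ∃; ∃-syntax; proj₁)
open import Data.Rational.Base as ℚ using (ℚ; 0ℚ; 1ℚ; ½; _<_; _≤_; ↥_; ↧ₙ_)
open import Data.Sum.Base using (_⊎_)
open import Relation.Binary.PropositionalEquality.Core using (_≡_)

------------------------------------------------------------------------
-- Ramsey numbers.  The set [n] is represented by Fin n.

Combinations : ℕ → ℕ → Set
Combinations n a = ∃[ S ] (∣_∣ {n} S ≡ a)

Coloring : ℕ → ℕ → Set
Coloring n a = Combinations n a → Fin 2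

Homogeneous : ∀ {n a} → Coloring n a → Subset n → Set
Homogeneous {n} {a} COL H =
  (S T : Combinations n a) → proj₁ S ⊆ H → proj₁ T ⊆ H → COL S ≡ COL T

RamseyProperty : ℕ → ℕ → ℕ → Set
RamseyProperty a k n =
  (COL : Coloring n a) → ∃[ H ] (∣ H ∣ ≡ k × Homogeneous COL H)

IsRamseyNumber : ℕ → ℕ → ℕ → Set
IsRamseyNumber a k R =
  RamseyProperty a k R × (∀ n → RamseyProperty a k n → R ℕ.≤ n)

------------------------------------------------------------------------
-- Real numbers as two-sided Dedekind cuts of ℚ: lower x q means q < x
-- and upper x q means x < q.  The record does not carry the Dedekind
-- axioms; the partial operations below say for which arguments the
-- result is the cut of the intended real number.

record Cut : Set₁ where
  field
    lower : ℚ → Set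
    upper : ℚ → Set

open Cut public

infix  4 _≤ʳ_
infixl 7 _*ʳ_ _/ʳ_
infixr 8 _^ʳ_
infix  9 √_ 2^ʳ_

_≤ʳ_ : Cut → Cut → Set
x ≤ʳ y = ∀ q → lower x q → lower y q

fromℕ : ℕ → Cut
fromℕ n = record
  { lower = λ q → q < + n ℚ./ 1
  ; upper = λ q → + n ℚ./ 1 < q
  }

-- xy is compared with q through a box (a , b) × (c , d) of rational
-- bounds around (x , y): the extreme values of the product on the box
-- are attained at its corners.  Valid for x and y of any sign.
_*ʳ_ : Cut → Cut → Cut
x *ʳ y = record
  { lower = λ q → Box λ a b c d →
      q < a ℚ.* c × q < a ℚ.* d × q < b ℚ.* c × q < b ℚ.* d
  ; upper = λ q → Box λ a b c d →
      a ℚ.* c < q × a ℚ.* d < q × b ℚ.* c < q × b ℚ.* d < q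
  }
  where
  Box : (ℚ → ℚ → ℚ → ℚ → Set) → Set
  Box P = ∃[ a ] ∃[ b ] ∃[ c ] ∃[ d ]
    (lower x a × upper x b × lower y c × upper y d × P a b c d)

_^ʳ_ : Cut → ℕ → Cut
x ^ʳ zero  = fromℕ 1
x ^ʳ suc n = x *ʳ x ^ʳ n

-- The reciprocal of x, for x > 0.
recip : Cut → Cut
recip x = record
  { lower = λ q → ∃[ r ] (upper x r × q ℚ.* r < 1ℚ)
  ; upper = λ q → ∃[ r ] (0ℚ < r × lower x r × 1ℚ < q ℚ.* r)
  }

-- Division, for a positive divisor.
_/ʳ_ : Cut → Cut → Cut
x /ʳ y = x *ʳ recip y

-- The square root of x, for x ≥ 0.
√_ : Cut → Cut
√ x = record
  { lower = λ q → q < 0ℚ ⊎ lower x (q ℚ.* q)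
  ; upper = λ q → 0ℚ < q × upper x (q ℚ.* q)
  }

_^ℚ_ : ℚ → ℕ → ℚ
_^ℚ_ = _^_ ℚ.+-*-rawSemiring

2^ℤ_ : ℤ → ℚ
2^ℤ (+ n)    = (+ 2 ℚ./ 1) ^ℚ n
2^ℤ -[1+ n ] = ½ ^ℚ suc n

-- For r = m/d with d > 0, the comparison of q > 0 with 2^r is that of
-- q^d with 2^m.
_<2^_ : ℚ → ℚ → Set
q <2^ r = q ≤ 0ℚ ⊎ (q ^ℚ (↧ₙ r)) < (2^ℤ (↥ r))

2^_<_ : ℚ → ℚ → Set
2^ r < q = 0ℚ < q × (2^ℤ (↥ r)) < (q ^ℚ (↧ₙ r))

-- 2^x is the supremum of 2^r over rationals r < x and the infimum of 2^r
-- over rationals r > x.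
2^ʳ_ : Cut → Cut
2^ʳ x = record
  { lower = λ q → ∃[ r ] (lower x r × q <2^ r)
  ; upper = λ q → ∃[ r ] (upper x r × 2^ r < q)
  }

-- The limit of a convergent sequence.
lim : (ℕ → ℚ) → Cut
lim s = record
  { lower = λ q → ∃[ r ] (q < r × ∃[ N ] (∀ n → N ℕ.≤ n → r ≤ s n))
  ; upper = λ q → ∃[ r ] (r < q × ∃[ N ] (∀ n → N ℕ.≤ n → s n ≤ r))
  }

partialSum : (ℕ → ℚ) → ℕ → ℚ
partialSum f zero    = 0ℚ
partialSum f (suc n) = partialSum f n ℚ.+ f n

e : Cut
e = lim (partialSum λ i → (+ 1 ℚ./ (i !)) {{i !≢0}})

-- π = 4 - 4/3 + 4/5 - 4/7 + ⋯
π : Cut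
π = lim (partialSum λ i → (-1ℤ ℤ.^ i ℤ.* + 4) ℚ./ suc (2 ℕ.* i))

B : Cut
B = (e /ʳ √ (fromℕ 2 *ʳ π)) ^ʳ 3

{-# OPTIONS --safe #-}
module Submission where

-- Expose the triples lazily: arrange the chosen vertices as a binary search
-- tree in which w lies to the left (right) of its ancestor v when all triples
-- v, w, y with y still available have color 0 (1).  A new vertex descends from
-- the root; at each node the majority color among the available vertices is
-- chosen and the minority discarded.  The left (right) ancestors of a vertex
-- form, with it and any available vertex, a homogeneous set, so with at most
-- m = k - 2 turns of either kind the game ends after at most C(2m, m)
-- insertions, each of which costs at most 2m + 1 halvings.  Therefore
-- R(3, k) ≤ 2 ^ ((2m + 1) C(2m, m)), and (2m + 1) C(2m, m)² ≤ 16 ^ m together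
-- with B > 1/2 (from e > 13/5 and π < 41/10) gives the bound.

open import Defs
open import Data.Bool.Base using (true; false)
open import Data.Fin.Base using (Fin; zero; suc)
open import Data.Fin.Properties using () renaming (_≟_ to _≟ᶠ_)
open import Data.Fin.Subset using (Subset; inside; outside; ⁅_⁆; _∪_; ∣_∣) renaming (⊥ to ∅; ⊤ to full; _∈_ to _∈ˢ_; _∉_ to _∉ˢ_; _⊆_ to _⊆ˢ_)
open import Data.Fin.Subset.Properties using (∣⊥∣≡0; ∣p∣≤n; ∉⊥; ∪-identityˡ; x∈p∪q⁺; x∈p∪q⁻; x∈⁅x⁆; x∈⁅y⁆⇒x≡y; ⊆-antisym; _∈?_; _⊆?_; anySubset?)
open import Data.Integer.Base as ℤ using (+[1+_]; -1ℤ; 1ℤ)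
import Data.Integer.Properties as ℤₚ
open import Data.List.Base using (List; []; _∷_; length; filter; foldr)
open import Data.List.Membership.Propositional using (_∈_)
open import Data.List.Membership.Propositional.Properties using (∈-filter⁺; ∈-filter⁻)
open import Data.List.Properties using (length-tabulate)
open import Data.List.Relation.Binary.Subset.Propositional using (_⊆_)
open import Data.List.Relation.Binary.Subset.Propositional.Properties using (filter-⊆)
open import Data.List.Relation.Unary.All as All using (All; []; _∷_)
import Data.List.Relation.Unary.All.Properties as Allₚ
open import Data.List.Relation.Unary.AllPairs using (AllPairs; []; _∷_)
import Data.List.Relation.Unary.AllPairs.Properties as AllPairsₚ
open import Data.List.Relation.Unary.Any using (here; there)
open import Data.List.Relation.Unary.Unique.Propositional using (Unique)
import Data.List.Relation.Unary.Unique.Propositional.Properties as Uniqueₚ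
open import Data.Nat.Base using (ℕ; zero; suc; pred; _+_; _∸_; _*_; _^_; _≤_; _<_; z≤n; s≤s; _!; NonZero; >-nonZero⁻¹)
import Data.Nat.Coprimality as Coprime
open import Data.Nat.Properties
open import Data.Nat.Solver using (module +-*-Solver)
open import Data.Product.Base using (_×_; _,_; ∃-syntax; proj₁; proj₂)
open import Data.Rational.Base as ℚ using (ℚ; mkℚ; 0ℚ; 1ℚ; ½; fromℚᵘ; toℚᵘ)
import Data.Rational.Properties as ℚₚ
import Data.Rational.Solver as ℚ-Solver
open import Data.Rational.Unnormalised.Base as ℚᵘ using (mkℚᵘ)
import Data.Rational.Unnormalised.Properties as ℚᵘₚ
open import Data.Sum.Base as Sum using (_⊎_; inj₁; inj₂; [_,_])
open import Data.Unit.Base using (⊤; tt)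
open import Data.Vec.Base as Vec using ([]; _∷_)
open import Function.Base using (_∘_; id)
open import Level using (Level)
open import Relation.Binary.PropositionalEquality hiding ([_])
open import Relation.Nullary using (Dec; yes; no; ¬_; ¬?; contradiction; _×-dec_; _→-dec_)
open import Relation.Nullary.Decidable using (True; toWitness; map′; decidable-stable)
open import Relation.Unary using (Pred; Decidable)

private
  variable
    ℓ : Level
    A : Set ℓ

-- The tree game

-- The number of nodes of a full `Tree i j`. By Pascal's rule it is one less than the binomial
-- coefficient i + j choose i.
slots : ℕ → ℕ → ℕ
slots zero    j       = 0
slots (suc i) zero    = 0
slots (suc i) (suc j) = suc (slots i (suc j) + slots (suc i) j)

length-filter-split : {P : Pred A ℓ} (P? : Decidable P) (xs : List A) →
  length (filter P? xs) + length (filter (¬? ∘ P?) xs) ≡ length xs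
length-filter-split P? []       = refl
length-filter-split P? (x ∷ xs) with P? x
... | yes _ = cong suc (length-filter-split P? xs)
... | no  _ = trans (+-suc _ _) (cong suc (length-filter-split P? xs))

2*≤+⇒≤⊎≤ : ∀ q {a b} → 2 * q ≤ a + b → q ≤ a ⊎ q ≤ b
2*≤+⇒≤⊎≤ q {a} {b} h with q ≤? a
... | yes q≤a = inj₁ q≤a
... | no  q≰a = inj₂ (+-cancelˡ-≤ q q b (begin
  q + q        ≡⟨ cong (q +_) (+-identityʳ q) ⟨
  2 * q        ≤⟨ h ⟩
  a + b        ≤⟨ +-monoˡ-≤ b (≰⇒≥ q≰a) ⟩
  q + b        ∎))
  where open ≤-Reasoning

module Game {n : ℕ} (χ : Fin n → Fin n → Fin n → Fin 2) where

  -- The head of the list is the last vertex: the triple a, b, x of a list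
  -- x ∷ … b … a … has color χ a b x.
  Hom : Fin 2 → List (Fin n) → Set
  Hom col []       = ⊤
  Hom col (x ∷ xs) =
    All (x ≢_) xs × AllPairs (λ b a → χ a b x ≡ col) xs × Hom col xs

  HomogeneousList : ℕ → Set
  HomogeneousList k = ∃[ col ] ∃[ xs ] (length xs ≡ k × Hom col xs)

  -- A triple of the longer list that omits v, x or y lies in one of the three given lists; the only
  -- other triple is v, x, y itself, whose color is the first hypothesis.
  Hom-insert : ∀ {col x y v xs} → χ v x y ≡ col →
    Hom col (y ∷ x ∷ xs) → Hom col (y ∷ v ∷ xs) → Hom col (x ∷ v ∷ xs) →
    Hom col (y ∷ x ∷ v ∷ xs)
  Hom-insert c (y≢x ∷ _ , yxs ∷ _ , _) (y≢vxs , yvxs , _) hx =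
    y≢x ∷ y≢vxs , (c ∷ yxs) ∷ yvxs , hx

  -- A vertex w in the left (right) subtree of v has χ v w y ≡ 0 (1) for
  -- every later vertex y.  The indices bound the left and right turns
  -- still available below a node.
  data Tree : ℕ → ℕ → Set where
    leaf : ∀ {i j} → Tree i j
    node : ∀ {i j} → Fin n → Tree i (suc j) → Tree (suc i) j →
           Tree (suc i) (suc j)

  free : ∀ {i j} → Tree i j → ℕ
  free {i} {j} leaf   = slots i j
  free (node _ l r)   = free l + free r

  -- Both chains of ancestors stay extendable by v and one more candidate, so m ancestors of one
  -- kind already yield m + 2 vertices.
  Extends : List (Fin n) → List (Fin n) → Fin n → List (Fin n) → Set
  Extends As Bs v S = ∀ {y} → y ∈ S →
    Hom zero (y ∷ v ∷ As) × Hom (suc zero) (y ∷ v ∷ Bs)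

  -- As and Bs are the ancestors left by a left and by a right turn, and S
  -- is the list of candidates for later vertices.
  Invariant : ∀ {i j} → Tree i j → (As Bs S : List (Fin n)) → Set
  Invariant leaf         As Bs S = ⊤
  Invariant (node v l r) As Bs S =
    Extends As Bs v S × Invariant l (v ∷ As) Bs S × Invariant r As (v ∷ Bs) S

  Invariant-anti : ∀ {i j} (t : Tree i j) {As Bs S S′} → S′ ⊆ S →
    Invariant t As Bs S → Invariant t As Bs S′
  Invariant-anti leaf         S′⊆S _              = tt
  Invariant-anti (node v l r) S′⊆S (ext , il , ir) =
    (λ y∈S′ → ext (S′⊆S y∈S′)) , Invariant-anti l S′⊆S il , Invariant-anti r S′⊆S ir

  record Inserted {i j} (t : Tree i j) (As Bs S : List (Fin n)) (p : ℕ) : Set where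
    field
      tree       : Tree i j
      candidates : List (Fin n)
      subset     : candidates ⊆ S
      unique     : Unique candidates
      invariant  : Invariant tree As Bs candidates
      fills      : suc (free tree) ≡ free t
      large      : p ≤ length candidates

  -- Each turn of x on its way down uses up one of the i + j available turns and keeps at least half
  -- of the candidates, so p of them survive. The two length equations say that a chain has m
  -- vertices once its turns are exhausted.
  insert : ∀ {i j} (t : Tree i j) {m As Bs x S p} →
    length As + i ≡ m → length Bs + j ≡ m →
    Invariant t As Bs (x ∷ S) → Extends As Bs x S → Unique S →
    1 ≤ p → 2 ^ (i + j) * p ≤ length S →
    HomogeneousList (2 + m) ⊎ Inserted t As Bs S p
  insert {i} {j} leaf {S = []} {p} a b inv ext uniq 1≤p h =
    contradiction (≤-trans (*-mono-≤ (m^n>0 2 (i + j)) 1≤p) h) λ ()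
  -- No left turn remains, so `As` has m vertices, and x and any candidate y complete it. A
  -- candidate exists because `1 ≤ p`.
  insert {zero} leaf {As = As} {x = x} {S = y ∷ S} a b inv ext uniq 1≤p h =
    inj₁ (zero , y ∷ x ∷ As ,
          cong (2 +_) (trans (sym (+-identityʳ _)) a) , proj₁ (ext (here refl)))
  insert {suc i} {zero} leaf {Bs = Bs} {x = x} {S = y ∷ S} a b inv ext uniq 1≤p h =
    inj₁ (suc zero , y ∷ x ∷ Bs ,
          cong (2 +_) (trans (sym (+-identityʳ _)) b) , proj₂ (ext (here refl)))
  insert {suc i} {suc j} leaf {x = x} {S = S@(_ ∷ _)} {p} a b inv ext uniq 1≤p h = inj₂ record
    { tree       = node x leaf leaf
    ; candidates = S
    ; subset     = id
    ; unique     = uniq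
    ; invariant  = ext , tt , tt
    ; fills      = refl
    ; large      = ≤-trans (≤-trans (≤-reflexive (sym (*-identityˡ p)))
                     (*-monoˡ-≤ p (m^n>0 2 (suc i + suc j)))) h
    }
  insert {suc i} {suc j} (node v l r) {m} {As} {Bs} {x} {S} {p} a b (extᵛ , il , ir) ext uniq 1≤p h =
    [ goLeft , goRight ] (2*≤+⇒≤⊎≤ (2 ^ (i + suc j) * p) (begin
      2 * (2 ^ (i + suc j) * p)     ≡⟨ *-assoc 2 (2 ^ (i + suc j)) p ⟨
      2 ^ (suc i + suc j) * p       ≤⟨ h ⟩
      length S                      ≡⟨ length-filter-split zero? S ⟨
      length Sˡ + length Sʳ         ∎))
    where
    open ≤-Reasoning
    zero? : Decidable (λ y → χ v x y ≡ zero)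
    zero? y = χ v x y ≟ᶠ zero
    Sˡ Sʳ : List (Fin n)
    Sˡ = filter zero? S
    Sʳ = filter (¬? ∘ zero?) S

    ≢0⇒≡1 : {c : Fin 2} → c ≢ zero → c ≡ suc zero
    ≢0⇒≡1 {zero}     c≢0 = contradiction refl c≢0
    ≢0⇒≡1 {suc zero} _   = refl

    weaken : ∀ {P : Pred (Fin n) _} (P? : Decidable P) {S′} → S′ ⊆ filter P? S → S′ ⊆ x ∷ S
    weaken P? sub = there ∘ filter-⊆ P? S ∘ sub

    goLeft : 2 ^ (i + suc j) * p ≤ length Sˡ → HomogeneousList (2 + m) ⊎ Inserted (node v l r) As Bs S p
    goLeft hˡ with insert l {As = v ∷ As} (trans (sym (+-suc _ _)) a) b
                     (Invariant-anti l shrink il) extˡ (Uniqueₚ.filter⁺ zero? uniq) 1≤p hˡ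
      where
      shrink : x ∷ Sˡ ⊆ x ∷ S
      shrink (here eq)  = here eq
      shrink (there y∈) = there (filter-⊆ zero? S y∈)
      extˡ : Extends (v ∷ As) Bs x Sˡ
      extˡ y∈ with ∈-filter⁻ zero? {xs = S} y∈
      -- The hypothesis on v is applied to y and also to x, which is why the invariant is assumed
      -- for `x ∷ S` and not just for `S`.
      ... | y∈S , c = Hom-insert c (proj₁ (ext y∈S)) (proj₁ (extᵛ (there y∈S))) (proj₁ (extᵛ (here refl)))
                    , proj₂ (ext y∈S)
    ... | inj₁ win = inj₁ win
    ... | inj₂ ins = inj₂ record
      { tree       = node v tree r
      ; candidates = candidates
      ; subset     = filter-⊆ zero? S ∘ subset
      ; unique     = unique
      ; invariant  = (λ y∈ → extᵛ (weaken zero? subset y∈)) , invariant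
                   , Invariant-anti r (weaken zero? subset) ir
      ; fills      = cong (_+ free r) fills
      ; large      = large
      } where open Inserted ins

    goRight : 2 ^ (i + suc j) * p ≤ length Sʳ → HomogeneousList (2 + m) ⊎ Inserted (node v l r) As Bs S p
    goRight hʳ with insert r {Bs = v ∷ Bs} a (trans (sym (+-suc _ _)) b)
                     (Invariant-anti r shrink ir) extʳ (Uniqueₚ.filter⁺ (¬? ∘ zero?) uniq) 1≤p
                     (≤-trans (≤-reflexive (cong (λ d → 2 ^ d * p) (sym (+-suc i j)))) hʳ)
      where
      shrink : x ∷ Sʳ ⊆ x ∷ S
      shrink (here eq)  = here eq
      shrink (there y∈) = there (filter-⊆ (¬? ∘ zero?) S y∈)
      extʳ : Extends As (v ∷ Bs) x Sʳ
      extʳ y∈ with ∈-filter⁻ (¬? ∘ zero?) {xs = S} y∈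
      ... | y∈S , c = proj₁ (ext y∈S)
                    , Hom-insert (≢0⇒≡1 c) (proj₂ (ext y∈S)) (proj₂ (extᵛ (there y∈S))) (proj₂ (extᵛ (here refl)))
    ... | inj₁ win = inj₁ win
    ... | inj₂ ins = inj₂ record
      { tree       = node v l tree
      ; candidates = candidates
      ; subset     = filter-⊆ (¬? ∘ zero?) S ∘ subset
      ; unique     = unique
      ; invariant  = (λ y∈ → extᵛ (weaken (¬? ∘ zero?) subset y∈))
                   , Invariant-anti l (weaken (¬? ∘ zero?) subset) il , invariant
      ; fills      = trans (sym (+-suc _ _)) (cong (free l +_) fills)
      ; large      = large
      } where open Inserted ins

  -- Induction on the number f of free slots: every round that does not win fills one slot, so round
  -- f + 1 must win. A round is charged 2m + 1 factors of 2.
  play : ∀ m f (t : Tree m m) {S} → free t ≡ f → Invariant t [] [] S → Unique S →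
    2 ^ (suc (m + m) * suc f) ≤ length S → HomogeneousList (2 + m)
  play m f t {[]} _ _ _ h = contradiction (≤-trans (m^n>0 2 (suc (m + m) * suc f)) h) λ ()
  play m f t {x ∷ S} eq inv (x∉S ∷ uniq) h = continue f eq
      (insert t refl refl inv ext uniq (m^n>0 2 (d * f)) room)
    where
    d : ℕ
    d = suc (m + m)
    ext : Extends [] [] x S
    ext y∈S = (y≢x ∷ [] , [] ∷ [] , [] , [] , tt) , (y≢x ∷ [] , [] ∷ [] , [] , [] , tt)
      where y≢x = ≢-sym (All.lookup x∉S y∈S)
    -- The insertion uses 2m of the 2m + 1 halvings; the last one pays for removing x from the
    -- candidates.
    room : 2 ^ (m + m) * 2 ^ (d * f) ≤ length S
    room = +-cancelˡ-≤ 1 _ _ (begin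
      1 + q            ≤⟨ +-monoˡ-≤ q (*-mono-≤ (m^n>0 2 (m + m)) (m^n>0 2 (d * f))) ⟩
      q + q            ≡⟨ cong (q +_) (+-identityʳ q) ⟨
      2 * q            ≡⟨ *-assoc 2 (2 ^ (m + m)) (2 ^ (d * f)) ⟨
      2 ^ d * 2 ^ (d * f)   ≡⟨ ^-distribˡ-+-* 2 d (d * f) ⟨
      2 ^ (d + d * f)  ≡⟨ cong (2 ^_) (*-suc d f) ⟨
      2 ^ (d * suc f)  ≤⟨ h ⟩
      suc (length S)   ∎)
      where
      open ≤-Reasoning
      q = 2 ^ (m + m) * 2 ^ (d * f)
    continue : ∀ f → free t ≡ f →
      HomogeneousList (2 + m) ⊎ Inserted t [] [] S (2 ^ (d * f)) → HomogeneousList (2 + m)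
    continue f       eq (inj₁ win) = win
    -- A full tree has no slot for an unsuccessful round to fill.
    continue zero    eq (inj₂ ins) = contradiction (trans (Inserted.fills ins) eq) λ ()
    continue (suc f) eq (inj₂ ins) =
      play m f tree (suc-injective (trans fills eq)) invariant unique large
      where open Inserted ins

  homogeneousList : ∀ m → 2 ^ (suc (m + m) * suc (slots m m)) ≤ n → HomogeneousList (2 + m)
  homogeneousList m h = play m (slots m m) leaf refl tt (Uniqueₚ.allFin⁺ n)
    (subst (_ ≤_) (sym (length-tabulate {n = n} id)) h)

-- From homogeneous lists to homogeneous sets

toSubset : ∀ {n} → List (Fin n) → Subset n
toSubset = foldr (λ x p → ⁅ x ⁆ ∪ p) ∅

∈-toSubset⁺ : ∀ {n} {x : Fin n} {xs} → x ∈ xs → x ∈ˢ toSubset xs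
∈-toSubset⁺ (here refl) = x∈p∪q⁺ (inj₁ (x∈⁅x⁆ _))
∈-toSubset⁺ (there x∈) = x∈p∪q⁺ (inj₂ (∈-toSubset⁺ x∈))

∈-toSubset⁻ : ∀ {n} {x : Fin n} xs → x ∈ˢ toSubset xs → x ∈ xs
∈-toSubset⁻ []       x∈ = contradiction x∈ ∉⊥
∈-toSubset⁻ (y ∷ xs) x∈ with x∈p∪q⁻ ⁅ y ⁆ _ x∈
... | inj₁ x∈y  = here (x∈⁅y⁆⇒x≡y y x∈y)
... | inj₂ x∈xs = there (∈-toSubset⁻ xs x∈xs)

∣⁅x⁆∪p∣≡1+∣p∣ : ∀ {n} (x : Fin n) (p : Subset n) → x ∉ˢ p → ∣ ⁅ x ⁆ ∪ p ∣ ≡ suc ∣ p ∣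
∣⁅x⁆∪p∣≡1+∣p∣ zero    (inside  ∷ p) x∉p = contradiction Vec.here x∉p
∣⁅x⁆∪p∣≡1+∣p∣ zero    (outside ∷ p) x∉p = cong (suc ∘ ∣_∣) (∪-identityˡ p)
∣⁅x⁆∪p∣≡1+∣p∣ (suc x) (inside  ∷ p) x∉p = cong suc (∣⁅x⁆∪p∣≡1+∣p∣ x p (x∉p ∘ Vec.there))
∣⁅x⁆∪p∣≡1+∣p∣ (suc x) (outside ∷ p) x∉p = ∣⁅x⁆∪p∣≡1+∣p∣ x p (x∉p ∘ Vec.there)

∣toSubset∣ : ∀ {n} {xs : List (Fin n)} → Unique xs → ∣ toSubset xs ∣ ≡ length xs
∣toSubset∣ {n} {[]}     []            = ∣⊥∣≡0 n
∣toSubset∣ {n} {x ∷ xs} (x∉xs ∷ uniq) =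
  trans (∣⁅x⁆∪p∣≡1+∣p∣ x _ λ x∈ → All.lookup x∉xs (∈-toSubset⁻ xs x∈) refl)
        (cong suc (∣toSubset∣ uniq))

-- Lists the elements of S in the order of xs, which is the order in which `Hom` reads off colors.
toSubset-filter : ∀ {n} (S : Subset n) xs → S ⊆ˢ toSubset xs → toSubset (filter (_∈? S) xs) ≡ S
toSubset-filter S xs S⊆xs = ⊆-antisym
  (λ x∈ → proj₂ (∈-filter⁻ (_∈? S) {xs = xs} (∈-toSubset⁻ _ x∈)))
  (λ x∈S → ∈-toSubset⁺ (∈-filter⁺ (_∈? S) (∈-toSubset⁻ xs (S⊆xs x∈S)) x∈S))

module _ {n : ℕ} (COL : Coloring n 3) where

  tripleColor : Fin n → Fin n → Fin n → Fin 2
  tripleColor a b x with ∣ toSubset (x ∷ b ∷ a ∷ []) ∣ ≟ 3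
  ... | yes p = COL (toSubset (x ∷ b ∷ a ∷ []) , p)
  -- An arbitrary color for degenerate triples; the vertices of a `Hom` list are distinct.
  ... | no  _ = zero

  tripleColor-≡ : ∀ a b x (p : ∣ toSubset (x ∷ b ∷ a ∷ []) ∣ ≡ 3) →
    tripleColor a b x ≡ COL (toSubset (x ∷ b ∷ a ∷ []) , p)
  tripleColor-≡ a b x p with ∣ toSubset (x ∷ b ∷ a ∷ []) ∣ ≟ 3
  ... | yes q = cong (λ r → COL (toSubset (x ∷ b ∷ a ∷ []) , r)) (≡-irrelevant q p)
  ... | no ¬p = contradiction p ¬p

  open Game tripleColor

  Hom⇒Unique : ∀ {col} xs → Hom col xs → Unique xs
  Hom⇒Unique []       _               = []
  Hom⇒Unique (x ∷ xs) (x∉xs , _ , hom) = x∉xs ∷ Hom⇒Unique xs hom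

  Hom-filter : ∀ {col} {P : Pred (Fin n) ℓ} (P? : Decidable P) xs →
    Hom col xs → Hom col (filter P? xs)
  Hom-filter P? []       _ = tt
  Hom-filter P? (x ∷ xs) (x∉xs , pairs , hom) with P? x
  ... | yes _ = Allₚ.filter⁺ P? x∉xs , AllPairsₚ.filter⁺ P? pairs , Hom-filter P? xs hom
  ... | no  _ = Hom-filter P? xs hom

  Hom-triple : ∀ {col} ys → length ys ≡ 3 → Hom col ys → (p : ∣ toSubset ys ∣ ≡ 3) →
    COL (toSubset ys , p) ≡ col
  Hom-triple (x ∷ b ∷ a ∷ []) _ (_ , (c ∷ _) ∷ _ , _) p = trans (sym (tripleColor-≡ a b x p)) c

  -- A 3-subset, listed in the order of xs, is a sublist of a chain and hence a chain of three
  -- vertices, whose one color condition is the claim.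
  Hom⇒Homogeneous : ∀ {col} xs → Hom col xs → Homogeneous COL (toSubset xs)
  Hom⇒Homogeneous {col} xs hom S T S⊆xs T⊆xs = trans (color S S⊆xs) (sym (color T T⊆xs))
    where
    color : (S : Combinations n 3) → proj₁ S ⊆ˢ toSubset xs → COL S ≡ col
    color (S , p) S⊆xs =
      -- The size proof depends on the set, so the transport is of the claim for all size proofs.
      subst (λ S′ → (p′ : ∣ S′ ∣ ≡ 3) → COL (S′ , p′) ≡ col) ys≡S
        (Hom-triple ys |ys|≡3 homys) p
      where
      ys = filter (_∈? S) xs
      homys = Hom-filter (_∈? S) xs hom
      ys≡S = toSubset-filter S xs S⊆xs
      |ys|≡3 = trans (sym (∣toSubset∣ (Hom⇒Unique ys homys))) (trans (cong ∣_∣ ys≡S) p)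

ramseyProperty-2^ : ∀ m → RamseyProperty 3 (2 + m) (2 ^ (suc (m + m) * suc (slots m m)))
ramseyProperty-2^ m COL with Game.homogeneousList (tripleColor COL) m ≤-refl
... | _ , xs , |xs|≡2+m , hom =
  toSubset xs , trans (∣toSubset∣ (Hom⇒Unique COL xs hom)) |xs|≡2+m , Hom⇒Homogeneous COL xs hom

ramseyProperty-1 : RamseyProperty 3 1 1
ramseyProperty-1 COL = full , refl , λ (S , p) _ _ _ →
  contradiction (≤-trans (≤-reflexive (sym p)) (∣p∣≤n S)) λ { (s≤s ()) }

-- Existence of Ramsey numbers

-- Functions on Subset n are compared only pointwise, so a predicate on
-- them can be decided by exhaustion only when it is extensional.
allFunctions? : ∀ n {P : Pred (Subset n → Fin 2) ℓ} →
  (∀ {f g} → f ≗ g → P f → P g) → Decidable P → Dec (∀ f → P f)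
allFunctions? zero {P} ext P? = map′
  (λ (p₀ , p₁) f → value f (f []) refl p₀ p₁)
  (λ h → h _ , h _)
  (P? (λ _ → zero) ×-dec P? (λ _ → suc zero))
  where
  value : ∀ f c → f [] ≡ c → P (λ _ → zero) → P (λ _ → suc zero) → P f
  value f zero       eq p₀ p₁ = ext (λ { [] → sym eq }) p₀
  value f (suc zero) eq p₀ p₁ = ext (λ { [] → sym eq }) p₁
allFunctions? (suc n) {P} ext P? = map′
  (λ h f → ext (λ { (true ∷ _) → refl ; (false ∷ _) → refl }) (h (f ∘ (true ∷_)) (f ∘ (false ∷_))))
  (λ h f g → h (glue f g))
  (allFunctions? n {λ f → ∀ g → P (glue f g)}
    (λ f≗f′ h g → ext (λ { (true ∷ p) → f≗f′ p ; (false ∷ _) → refl }) (h g))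
    λ f → allFunctions? n {λ g → P (glue f g)}
      (λ g≗g′ → ext λ { (true ∷ _) → refl ; (false ∷ p) → g≗g′ p })
      λ g → P? (glue f g))
  where
  glue : (f g : Subset n → Fin 2) → Subset (suc n) → Fin 2
  glue f g (true  ∷ p) = f p
  glue f g (false ∷ p) = g p

-- A coloring extends by a default color to all subsets, which reduces the search to
-- `allFunctions?`. Restricting the extension gives the coloring back only pointwise, hence the
-- extensionality hypothesis.
allColorings? : ∀ {n a} {P : Pred (Coloring n a) ℓ} →
  (∀ {C D} → C ≗ D → P C → P D) → Decidable P → Dec (∀ C → P C)
allColorings? {n = n} {a} {P} ext P? = map′
  (λ h C → ext (extend-∘ C) (h (extend C)))
  (λ h f → h (f ∘ proj₁))
  (allFunctions? n {λ f → P (f ∘ proj₁)} (λ f≗g → ext (f≗g ∘ proj₁)) (λ f → P? (f ∘ proj₁)))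
  where
  extend : Coloring n a → Subset n → Fin 2
  extend C S with ∣ S ∣ ≟ a
  ... | yes p = C (S , p)
  ... | no  _ = zero
  extend-∘ : ∀ C → extend C ∘ proj₁ ≗ C
  extend-∘ C (S , p) with ∣ S ∣ ≟ a
  ... | yes q = cong (λ r → C (S , r)) (≡-irrelevant q p)
  ... | no ¬p = contradiction p ¬p

allCombinations? : ∀ {n a} {P : Pred (Combinations n a) ℓ} → Decidable P → Dec (∀ S → P S)
allCombinations? {n = n} {a} {P} P? with anySubset? counterexample?
  where
  Counterexample : Pred (Subset n) _
  Counterexample S = ∃[ p ] ¬ P (S , p)
  counterexample? : Decidable Counterexample
  counterexample? S with ∣ S ∣ ≟ a
  ... | no ¬p = no (¬p ∘ proj₁)
  ... | yes p = map′ (p ,_)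
    (λ (q , ¬Pq) → subst (λ r → ¬ P (S , r)) (≡-irrelevant q p) ¬Pq) (¬? (P? (S , p)))
... | yes (S , p , ¬P) = no λ h → ¬P (h (S , p))
... | no  none         = yes λ (S , p) → decidable-stable (P? (S , p)) λ ¬P → none (S , p , ¬P)

homogeneous? : ∀ {n a} (C : Coloring n a) → Decidable (Homogeneous C)
homogeneous? C H = allCombinations? λ S → allCombinations? λ T →
  (proj₁ S ⊆? H) →-dec (proj₁ T ⊆? H) →-dec (C S ≟ᶠ C T)

-- Constructively, the least n is found by deciding the property at each number in turn; the
-- exhaustive searches above serve this purpose.
ramseyProperty? : ∀ a k → Decidable (RamseyProperty a k)
ramseyProperty? a k n = allColorings?
  (λ C≗D (H , |H|≡k , hom) →
    H , |H|≡k , λ S T S⊆H T⊆H → trans (sym (C≗D S)) (trans (hom S T S⊆H T⊆H) (C≗D T)))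
  (λ C → anySubset? λ H → (∣ H ∣ ≟ k) ×-dec homogeneous? C H)

least : {P : Pred ℕ ℓ} → Decidable P → ∀ n → P n → ∃[ m ] (P m × (∀ i → P i → m ≤ i))
least P? n Pn with P? 0
... | yes P0 = 0 , P0 , λ _ _ → z≤n
least P? zero    P0 | no ¬P0 = contradiction P0 ¬P0
least {P = P} P? (suc n) Pn | no ¬P0 with least (P? ∘ suc) n Pn
... | m , Pm , m≤ = suc m , Pm , λ
  { zero    P0 → contradiction P0 ¬P0
  ; (suc i) Pi → s≤s (m≤ i Pi) }

ramseyNumber : ∀ a k n → RamseyProperty a k n → ∃[ R ] (IsRamseyNumber a k R × R ≤ n)
ramseyNumber a k n Pn with least (ramseyProperty? a k) n Pn
... | R , PR , R≤ = R , (PR , R≤) , R≤ n Pn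

-- Central binomial coefficients

-- i + j choose i
binom : ℕ → ℕ → ℕ
binom i j = suc (slots i j)

-- Induction along Pascal's rule: the two summands contribute (i + 1) and (j + 1) times (i + j +
-- 1)!.
binom-! : ∀ i j → binom i j * (i ! * j !) ≡ (i + j) !
binom-! zero    j       = trans (*-identityˡ _) (*-identityˡ _)
binom-! (suc i) zero    = trans (*-identityˡ _) (trans (*-identityʳ (suc i !)) (cong _! (sym (+-identityʳ (suc i)))))
binom-! (suc i) (suc j) = begin
  binom (suc i) (suc j) * (suc i ! * suc j !)
    ≡⟨ solve 6 (λ p q a b x y →
         (con 2 :+ p :+ q) :* (((con 1 :+ a) :* x) :* ((con 1 :+ b) :* y)) :=
         (con 1 :+ a) :* ((con 1 :+ p) :* (x :* ((con 1 :+ b) :* y))) :+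
         (con 1 :+ b) :* ((con 1 :+ q) :* (((con 1 :+ a) :* x) :* y)))
       refl (slots i (suc j)) (slots (suc i) j) i j (i !) (j !) ⟩
  suc i * (binom i (suc j) * (i ! * suc j !)) + suc j * (binom (suc i) j * (suc i ! * j !))
    ≡⟨ cong₂ (λ u v → suc i * u + suc j * v) (binom-! i (suc j)) (binom-! (suc i) j) ⟩
  suc i * (i + suc j) ! + suc j * (suc i + j) !
    ≡⟨ cong (λ h → suc i * h ! + suc j * (suc i + j) !) (+-suc i j) ⟩
  suc i * (suc i + j) ! + suc j * (suc i + j) !
    ≡⟨ *-distribʳ-+ ((suc i + j) !) (suc i) (suc j) ⟨
  (suc i + suc j) * (suc i + j) !
    ≡⟨ cong (λ h → (suc i + suc j) * h !) (+-suc i j) ⟨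
  (suc i + suc j) ! ∎
  where
  open ≡-Reasoning
  open +-*-Solver

central : ℕ → ℕ
central m = binom m m

-- After multiplication by (m + 1) m!², both sides equal (2m + 2)! by `binom-!`.
central-suc : ∀ m → suc m * central (suc m) ≡ 2 * (suc (m + m) * central m)
central-suc m = *-cancelʳ-≡ _ _ (suc m * (m ! * m !)) {{m*n≢0 (suc m) _ {{_}} {{m*n≢0 (m !) (m !) {{m !≢0}} {{m !≢0}}}}}} (begin
  suc m * central (suc m) * (suc m * (m ! * m !))
    ≡⟨ solve 3 (λ k c x → k :* c :* (k :* (x :* x)) := c :* ((k :* x) :* (k :* x))) refl (suc m) (central (suc m)) (m !) ⟩
  central (suc m) * (suc m ! * suc m !)
    ≡⟨ binom-! (suc m) (suc m) ⟩
  (suc m + suc m) * (m + suc m) !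
    ≡⟨ cong (λ h → (suc m + suc m) * h !) (+-suc m m) ⟩
  (suc m + suc m) * (suc (m + m) * (m + m) !)
    ≡⟨ cong (λ h → (suc m + suc m) * (suc (m + m) * h)) (binom-! m m) ⟨
  (suc m + suc m) * (suc (m + m) * (central m * (m ! * m !)))
    ≡⟨ solve 4 (λ k d c x → (k :+ k) :* (d :* (c :* (x :* x))) := con 2 :* (d :* c) :* (k :* (x :* x))) refl (suc m) (suc (m + m)) (central m) (m !) ⟩
  2 * (suc (m + m) * central m) * (suc m * (m ! * m !)) ∎)
  where
  open ≡-Reasoning
  open +-*-Solver

-- By `central-suc`, passing to m + 1 multiplies the left side by 4 (2m + 1)(2m + 3) / (m + 1)²,
-- which is less than 16.
central-bound : ∀ m → suc (m + m) * (central m * central m) ≤ 16 ^ m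
central-bound zero    = s≤s z≤n
central-bound (suc m) = *-cancelˡ-≤ (suc m * suc m) (begin
  suc m * suc m * (suc (suc m + suc m) * (central (suc m) * central (suc m)))
    ≡⟨ solve 3 (λ k d c → k :* k :* (d :* (c :* c)) := d :* ((k :* c) :* (k :* c))) refl (suc m) (suc (suc m + suc m)) (central (suc m)) ⟩
  suc (suc m + suc m) * ((suc m * central (suc m)) * (suc m * central (suc m)))
    ≡⟨ cong (λ h → suc (suc m + suc m) * (h * h)) (central-suc m) ⟩
  suc (suc m + suc m) * (2 * (suc (m + m) * central m) * (2 * (suc (m + m) * central m)))
    ≡⟨ solve 3 (λ a b c → a :* (con 2 :* (b :* c) :* (con 2 :* (b :* c))) := con 4 :* (a :* b) :* (b :* (c :* c)))
         refl (suc (suc m + suc m)) (suc (m + m)) (central m) ⟩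
  4 * (suc (suc m + suc m) * suc (m + m)) * (suc (m + m) * (central m * central m))
    -- Adding 1 completes the square: (2m + 1)(2m + 3) + 1 = 4 (m + 1)².
    ≤⟨ *-mono-≤ (*-monoʳ-≤ 4 (n≤1+n (suc (suc m + suc m) * suc (m + m)))) (central-bound m) ⟩
  4 * suc (suc (suc m + suc m) * suc (m + m)) * 16 ^ m
    ≡⟨ solve 2 (λ m q → con 4 :* (con 1 :+ (con 1 :+ (con 1 :+ m :+ (con 1 :+ m))) :* (con 1 :+ (m :+ m))) :* q :=
         (con 1 :+ m) :* (con 1 :+ m) :* (con 16 :* q)) refl m (16 ^ m) ⟩
  suc m * suc m * 16 ^ suc m ∎)
  where
  open ≤-Reasoning
  open +-*-Solver

-- The exponent of 2 in the bound on the Ramsey number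

exponent : ℕ → ℕ
exponent m = suc (m + m) * central m

exponent>0 : ∀ m → 1 ≤ exponent m
exponent>0 m = s≤s z≤n

-- The square of 10 M < √(k - 1) 2^(2k) for k = m + 2, which avoids the root. The factor 10 leaves
-- room for the estimate of B and for strict inequalities.
exponent-bound : ∀ m → (10 * exponent m) * (10 * exponent m) < suc m * (2 ^ (2 * (2 + m)) * 2 ^ (2 * (2 + m)))
exponent-bound m = begin-strict
  (10 * exponent m) * (10 * exponent m)
    ≡⟨ solve 2 (λ d c → (con 10 :* (d :* c)) :* (con 10 :* (d :* c)) := con 100 :* d :* (d :* (c :* c))) refl (suc (m + m)) (central m) ⟩
  100 * suc (m + m) * (suc (m + m) * (central m * central m))
    ≤⟨ *-monoʳ-≤ (100 * suc (m + m)) (central-bound m) ⟩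
  100 * suc (m + m) * 16 ^ m
    -- The added 156 + 56 m raises 100 (2m + 1) to 256 (m + 1), that is 16² (m + 1).
    <⟨ *-monoˡ-< (16 ^ m) {{m^n≢0 16 m}} (m<m+n (100 * suc (m + m)) {156 + 56 * m} (s≤s z≤n)) ⟩
  (100 * suc (m + m) + (156 + 56 * m)) * 16 ^ m
    ≡⟨ solve 2 (λ m q → (con 100 :* (con 1 :+ (m :+ m)) :+ (con 156 :+ con 56 :* m)) :* q := (con 1 :+ m) :* (con 16 :* (con 16 :* q))) refl m (16 ^ m) ⟩
  suc m * 16 ^ (2 + m)
    ≡⟨ cong (suc m *_) (^-*-assoc 2 4 (2 + m)) ⟩
  suc m * 2 ^ (4 * (2 + m))
    ≡⟨ cong (λ h → suc m * 2 ^ h) (*-distribʳ-+ (2 + m) 2 2) ⟩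
  suc m * 2 ^ (2 * (2 + m) + 2 * (2 + m))
    ≡⟨ cong (suc m *_) (^-distribˡ-+-* 2 (2 * (2 + m)) (2 * (2 + m))) ⟩
  suc m * (2 ^ (2 * (2 + m)) * 2 ^ (2 * (2 + m))) ∎
  where
  open ≤-Reasoning
  open +-*-Solver

-- Rational arithmetic

eval-< : ∀ {p q} {_ : True (p ℚₚ.<? q)} → p ℚ.< q
eval-< {_} {_} {p<q} = toWitness p<q

eval-≤ : ∀ {p q} {_ : True (p ℚₚ.≤? q)} → p ℚ.≤ q
eval-≤ {_} {_} {p≤q} = toWitness p≤q

fromℚᵘ-homo-* : ∀ p q → fromℚᵘ p ℚ.* fromℚᵘ q ≡ fromℚᵘ (p ℚᵘ.* q)
fromℚᵘ-homo-* p q = ℚₚ.toℚᵘ-injective (begin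
  toℚᵘ (fromℚᵘ p ℚ.* fromℚᵘ q)          ≈⟨ ℚₚ.toℚᵘ-homo-* (fromℚᵘ p) (fromℚᵘ q) ⟩
  toℚᵘ (fromℚᵘ p) ℚᵘ.* toℚᵘ (fromℚᵘ q)  ≈⟨ ℚᵘₚ.*-cong (ℚₚ.toℚᵘ-fromℚᵘ p) (ℚₚ.toℚᵘ-fromℚᵘ q) ⟩
  p ℚᵘ.* q                              ≈⟨ ℚₚ.toℚᵘ-fromℚᵘ (p ℚᵘ.* q) ⟨
  toℚᵘ (fromℚᵘ (p ℚᵘ.* q))              ∎)
  where open import Relation.Binary.Reasoning.Setoid ℚᵘₚ.≃-setoid

fromℚᵘ-mono-≤ : ∀ {p q} → p ℚᵘ.≤ q → fromℚᵘ p ℚ.≤ fromℚᵘ q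
fromℚᵘ-mono-≤ {p} {q} p≤q = ℚₚ.toℚᵘ-cancel-≤ (begin
  toℚᵘ (fromℚᵘ p) ≃⟨ ℚₚ.toℚᵘ-fromℚᵘ p ⟩
  p               ≤⟨ p≤q ⟩
  q               ≃⟨ ℚₚ.toℚᵘ-fromℚᵘ q ⟨
  toℚᵘ (fromℚᵘ q) ∎)
  where open ℚᵘₚ.≤-Reasoning

fromℚᵘ-mono-< : ∀ {p q} → p ℚᵘ.< q → fromℚᵘ p ℚ.< fromℚᵘ q
fromℚᵘ-mono-< {p} {q} p<q = ℚₚ.toℚᵘ-cancel-< (begin-strict
  toℚᵘ (fromℚᵘ p) ≃⟨ ℚₚ.toℚᵘ-fromℚᵘ p ⟩
  p               <⟨ p<q ⟩
  q               ≃⟨ ℚₚ.toℚᵘ-fromℚᵘ q ⟨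
  toℚᵘ (fromℚᵘ q) ∎)
  where open ℚᵘₚ.≤-Reasoning

/-mono-≤ : ∀ a b c d .{{_ : NonZero b}} .{{_ : NonZero d}} →
  a * d ≤ c * b → ℤ.+ a ℚ./ b ℚ.≤ ℤ.+ c ℚ./ d
/-mono-≤ a b@(suc b-1) c d@(suc d-1) ad≤cb = fromℚᵘ-mono-≤ {mkℚᵘ (ℤ.+ a) b-1} {mkℚᵘ (ℤ.+ c) d-1} (ℚᵘ.*≤*
  (subst₂ ℤ._≤_ (ℤₚ.pos-* a d) (ℤₚ.pos-* c b) (ℤ.+≤+ ad≤cb)))

ι : ℕ → ℚ
ι n = ℤ.+ n ℚ./ 1

ι-mono-≤ : ∀ {m n} → m ≤ n → ι m ℚ.≤ ι n
ι-mono-≤ {m} {n} m≤n = /-mono-≤ m 1 n 1 (*-monoˡ-≤ 1 m≤n)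

ι-mono-< : ∀ {m n} → m < n → ι m ℚ.< ι n
ι-mono-< {m} {n} m<n = fromℚᵘ-mono-< {mkℚᵘ (ℤ.+ m) 0} {mkℚᵘ (ℤ.+ n) 0} (ℚᵘ.*<*
  (subst₂ ℤ._<_ (ℤₚ.pos-* m 1) (ℤₚ.pos-* n 1) (ℤ.+<+ (*-monoˡ-< 1 m<n))))

ι-homo-* : ∀ m n → ι (m * n) ≡ ι m ℚ.* ι n
ι-homo-* m n = trans (cong (ℚ._/ 1) (ℤₚ.pos-* m n))
  (sym (fromℚᵘ-homo-* (mkℚᵘ (ℤ.+ m) 0) (mkℚᵘ (ℤ.+ n) 0)))

0≤ι : ∀ n → 0ℚ ℚ.≤ ι n
0≤ι n = ι-mono-≤ {0} {n} z≤n

ι-^ : ∀ m n → ι (m ^ n) ≡ ι m ^ℚ n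
ι-^ m zero    = refl
ι-^ m (suc n) = trans (ι-homo-* m (m ^ n)) (cong (ι m ℚ.*_) (ι-^ m n))

a/d*d≡a : ∀ a d .{{_ : NonZero d}} → (ℤ.+ a ℚ./ d) ℚ.* ι d ≡ ι a
a/d*d≡a a d@(suc d-1) = trans (fromℚᵘ-homo-* (mkℚᵘ (ℤ.+ a) d-1) (mkℚᵘ (ℤ.+ d) 0))
  (ℚₚ.fromℚᵘ-cong {mkℚᵘ (ℤ.+ a) d-1 ℚᵘ.* mkℚᵘ (ℤ.+ d) 0} {mkℚᵘ (ℤ.+ a) 0}
    (ℚᵘ.*≡* (trans (ℤₚ.*-assoc (ℤ.+ a) (ℤ.+ d) (ℤ.+ 1)) (cong (ℤ.+ a ℤ.*_) (sym (ℤₚ.pos-* d 1))))))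

1/2b≡½*1/b : ∀ b .{{_ : NonZero b}} → (ℤ.+ 1 ℚ./ (2 * b)) {{m*n≢0 2 b}} ≡ ½ ℚ.* (ℤ.+ 1 ℚ./ b)
1/2b≡½*1/b (suc b-1) = sym (fromℚᵘ-homo-* (mkℚᵘ (ℤ.+ 1) 1) (mkℚᵘ (ℤ.+ 1) b-1))

*-mono-≤-nonNeg : ∀ {p q r s} → 0ℚ ℚ.≤ p → 0ℚ ℚ.≤ s → p ℚ.≤ q → r ℚ.≤ s → p ℚ.* r ℚ.≤ q ℚ.* s
*-mono-≤-nonNeg {p} {q} {r} {s} 0≤p 0≤s p≤q r≤s =
  ℚₚ.≤-trans (ℚₚ.*-monoˡ-≤-nonNeg p {{ℚ.nonNegative 0≤p}} r≤s) (ℚₚ.*-monoʳ-≤-nonNeg s {{ℚ.nonNegative 0≤s}} p≤q)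

0≤* : ∀ {p q} → 0ℚ ℚ.≤ p → 0ℚ ℚ.≤ q → 0ℚ ℚ.≤ p ℚ.* q
0≤* {p} {q} 0≤p 0≤q = ℚₚ.nonNegative⁻¹ _ {{ℚₚ.nonNeg*nonNeg⇒nonNeg p {{ℚ.nonNegative 0≤p}} q {{ℚ.nonNegative 0≤q}}}}

0<* : ∀ {p q} → 0ℚ ℚ.< p → 0ℚ ℚ.< q → 0ℚ ℚ.< p ℚ.* q
0<* {p} {q} 0<p 0<q = ℚₚ.positive⁻¹ _ {{ℚₚ.pos*pos⇒pos p {{ℚ.positive 0<p}} q {{ℚ.positive 0<q}}}}

-- Enclosures of cuts

-- With nonnegative bounds, a c is the least and b d the greatest of the four corners in `_*ʳ_`, so
-- one comparison settles each side of a product.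
record Between (x : Cut) (a b : ℚ) : Set where
  constructor between
  field
    0≤a : 0ℚ ℚ.≤ a
    a≤b : a ℚ.≤ b
    lo  : lower x a
    up  : upper x b

  0≤b : 0ℚ ℚ.≤ b
  0≤b = ℚₚ.≤-trans 0≤a a≤b

*-lower : ∀ {x y a b c d p} → Between x a b → Between y c d → p ℚ.< a ℚ.* c → lower (x *ʳ y) p
*-lower {a = a} {b} {c} {d} {p} X Y p<ac =
  a , b , c , d , X.lo , X.up , Y.lo , Y.up
  , p<ac
  , ℚₚ.<-≤-trans p<ac (*-mono-≤-nonNeg X.0≤a Y.0≤b ℚₚ.≤-refl Y.a≤b)
  , ℚₚ.<-≤-trans p<ac (*-mono-≤-nonNeg X.0≤a Y.0≤a X.a≤b ℚₚ.≤-refl)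
  , ℚₚ.<-≤-trans p<ac (*-mono-≤-nonNeg X.0≤a Y.0≤b X.a≤b Y.a≤b)
  where
  module X = Between X
  module Y = Between Y

*-Between : ∀ {x y a b c d p q} → Between x a b → Between y c d →
  0ℚ ℚ.≤ p → p ℚ.< a ℚ.* c → b ℚ.* d ℚ.< q → Between (x *ʳ y) p q
*-Between {a = a} {b} {c} {d} {p} {q} X Y 0≤p p<ac bd<q = between 0≤p
  (ℚₚ.<⇒≤ (ℚₚ.<-trans (ℚₚ.<-≤-trans p<ac (*-mono-≤-nonNeg X.0≤a Y.0≤b X.a≤b Y.a≤b)) bd<q))
  (*-lower X Y p<ac)
  ( a , b , c , d , X.lo , X.up , Y.lo , Y.up
  , ℚₚ.≤-<-trans (*-mono-≤-nonNeg X.0≤a Y.0≤b X.a≤b Y.a≤b) bd<q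
  , ℚₚ.≤-<-trans (*-mono-≤-nonNeg X.0≤a Y.0≤b X.a≤b ℚₚ.≤-refl) bd<q
  , ℚₚ.≤-<-trans (*-mono-≤-nonNeg X.0≤b Y.0≤b ℚₚ.≤-refl Y.a≤b) bd<q
  , bd<q )
  where
  module X = Between X
  module Y = Between Y

√-Between : ∀ {x a b} → 0ℚ ℚ.≤ a → a ℚ.≤ b → 0ℚ ℚ.< b →
  lower x (a ℚ.* a) → upper x (b ℚ.* b) → Between (√ x) a b
√-Between 0≤a a≤b 0<b a²<x x<b² = between 0≤a a≤b (inj₂ a²<x) (0<b , x<b²)

recip-Between : ∀ {x a b p q} → Between x a b → 0ℚ ℚ.< a → 0ℚ ℚ.≤ p → p ℚ.≤ q →
  p ℚ.* b ℚ.< 1ℚ → 1ℚ ℚ.< q ℚ.* a → Between (recip x) p q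
recip-Between {a = a} {b} X 0<a 0≤p p≤q pb<1 1<qa =
  between 0≤p p≤q (b , Between.up X , pb<1) (a , 0<a , Between.lo X , 1<qa)

fromℕ-Between : ∀ {n a b} → 0ℚ ℚ.≤ a → a ℚ.< ι n → ι n ℚ.< b → Between (fromℕ n) a b
fromℕ-Between 0≤a a<n n<b = between 0≤a (ℚₚ.<⇒≤ (ℚₚ.<-trans a<n n<b)) a<n n<b

lim-Between : ∀ {s a b p q} N → 0ℚ ℚ.≤ p → p ℚ.< a → b ℚ.< q →
  (∀ k → a ℚ.≤ s (N + k)) → (∀ k → s (N + k) ℚ.≤ b) → Between (lim s) p q
lim-Between {s} {a} {b} N 0≤p p<a b<q a≤s s≤b = between 0≤p
  (ℚₚ.<⇒≤ (ℚₚ.<-trans (ℚₚ.<-≤-trans p<a (ℚₚ.≤-trans (a≤s 0) (s≤b 0))) b<q))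
  (a , p<a , N , λ n N≤n → subst (λ n → a ℚ.≤ s n) (m+[n∸m]≡n N≤n) (a≤s (n ∸ N)))
  (b , b<q , N , λ n N≤n → subst (λ n → s n ℚ.≤ b) (m+[n∸m]≡n N≤n) (s≤b (n ∸ N)))

≤+ : ∀ {p q} → 0ℚ ℚ.≤ q → p ℚ.≤ p ℚ.+ q
≤+ {p} {q} 0≤q = subst (ℚ._≤ p ℚ.+ q) (ℚₚ.+-identityʳ p) (ℚₚ.+-monoʳ-≤ p 0≤q)

-- Bounds on e, π and B

1/[_]! : ℕ → ℚ
1/[ i ]! = (ℤ.+ 1 ℚ./ (i !)) {{i !≢0}}

0≤1/[_]! : ∀ i → 0ℚ ℚ.≤ 1/[ i ]!
0≤1/[ i ]! = /-mono-≤ 0 1 1 (i !) {{_}} {{i !≢0}} z≤n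

1/!-halves : ∀ i → 1/[ 2 + i ]! ℚ.≤ ½ ℚ.* 1/[ suc i ]!
1/!-halves i = subst (1/[ 2 + i ]! ℚ.≤_) (1/2b≡½*1/b (suc i !) {{suc i !≢0}})
  (/-mono-≤ 1 ((2 + i) !) 1 (2 * suc i !) {{(2 + i) !≢0}} {{m*n≢0 2 (suc i !) {{_}} {{suc i !≢0}}}}
    (*-monoʳ-≤ 1 (*-monoˡ-≤ (suc i !) {2} {2 + i} (s≤s (s≤s z≤n)))))

e-Between : Between e (ℤ.+ 13 ℚ./ 5) (ι 4)
e-Between = lim-Between 4 eval-≤ (eval-< {q = ℤ.+ 8 ℚ./ 3}) (eval-< {p = ι 3}) below above
  where
  s : ℕ → ℚ
  s = partialSum 1/[_]!
  below : ∀ k → ℤ.+ 8 ℚ./ 3 ℚ.≤ s (4 + k)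
  below zero    = eval-≤
  below (suc k) = ℚₚ.≤-trans (below k) (≤+ 0≤1/[ 4 + k ]!)
  -- Adding the next term twice makes the bound inductive: the term after it is at most half as
  -- large.
  slack : ∀ k → s (suc k) ℚ.+ (1/[ suc k ]! ℚ.+ 1/[ suc k ]!) ℚ.≤ ι 3
  slack zero    = eval-≤
  slack (suc k) = begin
    s (suc k) ℚ.+ f ℚ.+ (g ℚ.+ g)                 ≤⟨ ℚₚ.+-monoʳ-≤ (s (suc k) ℚ.+ f) (ℚₚ.+-mono-≤ (1/!-halves k) (1/!-halves k)) ⟩
    s (suc k) ℚ.+ f ℚ.+ (½ ℚ.* f ℚ.+ ½ ℚ.* f)     ≡⟨ solve 2 (λ s f → s :+ f :+ (con ½ :* f :+ con ½ :* f) := s :+ (f :+ f)) refl (s (suc k)) f ⟩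
    s (suc k) ℚ.+ (f ℚ.+ f)                       ≤⟨ slack k ⟩
    ι 3                                           ∎
    where
    open ℚₚ.≤-Reasoning
    open ℚ-Solver.+-*-Solver
    f = 1/[ suc k ]!
    g = 1/[ 2 + k ]!
  above : ∀ k → s (4 + k) ℚ.≤ ι 3
  above k = ℚₚ.≤-trans (≤+ (ℚₚ.≤-trans 0≤1/[ 4 + k ]! (≤+ 0≤1/[ 4 + k ]!))) (slack (3 + k))

leibniz : ℕ → ℚ
leibniz i = (-1ℤ ℤ.^ i ℤ.* ℤ.+ 4) ℚ./ suc (2 * i)

π-Between : Between π (ι 2) (ℤ.+ 41 ℚ./ 10)
π-Between = lim-Between 2 eval-≤ (eval-< {q = ℤ.+ 8 ℚ./ 3}) (eval-< {p = ι 4}) (proj₁ ∘ bounds) (proj₂ ∘ bounds)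
  where
  g : ℕ → ℚ
  g i = ℤ.+ 4 ℚ./ suc (2 * i)
  0≤g : ∀ i → 0ℚ ℚ.≤ g i
  0≤g i = /-mono-≤ 0 1 4 (suc (2 * i)) z≤n
  g-anti : ∀ i → g (suc i) ℚ.≤ g i
  g-anti i = /-mono-≤ 4 (suc (2 * suc i)) 4 (suc (2 * i)) (*-monoʳ-≤ 4 (s≤s (*-monoʳ-≤ 2 (n≤1+n i))))
  s : ℕ → ℚ
  s = partialSum leibniz
  lo hi : ℚ
  lo = ℤ.+ 8 ℚ./ 3
  hi = ι 4
  -- The invariant keeps both the current sum and the next one in the interval; as the terms
  -- decrease in size, every later sum stays between these two.
  Even Odd : ℕ → Set
  Even n = -1ℤ ℤ.^ n ≡ 1ℤ × lo ℚ.≤ s n × s n ℚ.+ g n ℚ.≤ hi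
  Odd  n = -1ℤ ℤ.^ n ≡ -1ℤ × lo ℚ.≤ s n ℚ.- g n × s n ℚ.≤ hi
  telescope : ∀ a b → a ℚ.+ b ℚ.- b ≡ a
  telescope = solve 2 (λ a b → a :+ b :- b := a) refl where open ℚ-Solver.+-*-Solver
  even⇒odd : ∀ n → Even n → Odd (suc n)
  even⇒odd n (sgn , lo≤s , s+g≤hi)
    rewrite cong (λ σ → (σ ℤ.* ℤ.+ 4) ℚ./ suc (2 * n)) sgn = cong (-1ℤ ℤ.*_) sgn
    , ℚₚ.≤-trans lo≤s (subst (ℚ._≤ s n ℚ.+ g n ℚ.- g (suc n)) (telescope (s n) (g n))
        (ℚₚ.+-monoʳ-≤ (s n ℚ.+ g n) (ℚₚ.neg-antimono-≤ (g-anti n))))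
    , s+g≤hi
  odd⇒even : ∀ n → Odd n → Even (suc n)
  odd⇒even n (sgn , lo≤s-g , s≤hi)
    rewrite cong (λ σ → (σ ℤ.* ℤ.+ 4) ℚ./ suc (2 * n)) sgn = cong (-1ℤ ℤ.*_) sgn
    , lo≤s-g
    , ℚₚ.≤-trans (ℚₚ.+-monoʳ-≤ (s n ℚ.- g n) (g-anti n)) (subst (ℚ._≤ hi) (sym (cancel (s n) (g n))) s≤hi)
    where
    cancel : ∀ a b → a ℚ.- b ℚ.+ b ≡ a
    cancel = solve 2 (λ a b → a :- b :+ b := a) refl where open ℚ-Solver.+-*-Solver
  parity : ∀ k → Even (2 + k) ⊎ Odd (2 + k)
  parity zero    = inj₁ (refl , eval-≤ , eval-≤)
  parity (suc k) = Sum.swap (Sum.map (even⇒odd (2 + k)) (odd⇒even (2 + k)) (parity k))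
  bounds : ∀ k → lo ℚ.≤ s (2 + k) × s (2 + k) ℚ.≤ hi
  bounds k with parity k
  ... | inj₁ (_ , lo≤s , s+g≤hi) = lo≤s , ℚₚ.≤-trans (≤+ (0≤g (2 + k))) s+g≤hi
  ... | inj₂ (_ , lo≤s-g , s≤hi) = ℚₚ.≤-trans lo≤s-g
    (subst (s (2 + k) ℚ.- g (2 + k) ℚ.≤_) (ℚₚ.+-identityʳ _)
      (ℚₚ.+-monoʳ-≤ (s (2 + k)) (ℚₚ.neg-antimono-≤ (0≤g (2 + k))))) , s≤hi

-- Lower ends: 2.6 · 0.32 > 0.83, and 0.83³ > 1/2 with room for rounding. The upper end only has to
-- be some finite bound.
B-Between : Between B ½ (ι 6000)
B-Between =
  *-Between c
    (*-Between {p = ℤ.+ 68 ℚ./ 100} {q = ι 400} c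
      (*-Between {p = ℤ.+ 82 ℚ./ 100} {q = ι 27} c
        -- The cube as defined by `_^ʳ_` ends in a factor 1, which needs a strict enclosure of its
        -- own.
        (fromℕ-Between {1} {ℤ.+ 99 ℚ./ 100} {ι 2} eval-≤ eval-< eval-<)
        eval-≤ eval-< eval-<)
      eval-≤ eval-< eval-<)
    eval-≤ eval-< eval-<
  where
  -- The ends are chosen for the root: 2.1 · 4.1 < 9 = 3² and 1 · 2 > 1/4 = (1/2)².
  2π : Between (fromℕ 2 *ʳ π) (ℤ.+ 1 ℚ./ 4) (ι 9)
  2π = *-Between (fromℕ-Between {2} {ι 1} {ℤ.+ 21 ℚ./ 10} eval-≤ eval-< eval-<) π-Between eval-≤ eval-< eval-<
  √2π : Between (√ (fromℕ 2 *ʳ π)) ½ (ι 3)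
  √2π = √-Between {fromℕ 2 *ʳ π} eval-≤ eval-≤ eval-< (Between.lo 2π) (Between.up 2π)
  c : Between (e /ʳ √ (fromℕ 2 *ʳ π)) (ℤ.+ 83 ℚ./ 100) (ι 13)
  c = *-Between e-Between (recip-Between {p = ℤ.+ 32 ℚ./ 100} {q = ι 3} √2π eval-< eval-≤ eval-≤ eval-< eval-<) eval-≤ eval-< eval-<

-- Powers of 2

-- For k = 1 the factor √0 has only negative rationals strictly below it, so `Between` does not
-- apply and a symmetric enclosure takes its place.
Near0 : Cut → ℚ → Set
Near0 x δ = 0ℚ ℚ.< δ × lower x (ℚ.- δ) × upper x δ

-- The corners b δ and b (- δ) dominate the box.
*-Near0 : ∀ {x y a b δ ε} → Between x a b → Near0 y δ → b ℚ.* δ ℚ.< ε → Near0 (x *ʳ y) ε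
*-Near0 {a = a} {b} {δ} {ε} X (0<δ , -δ<y , y<δ) bδ<ε =
  0<ε
  , (a , b , ℚ.- δ , δ , X.lo , X.up , -δ<y , y<δ , above X.a≤b , -ε< X.0≤a , above ℚₚ.≤-refl , -ε< X.0≤b)
  , (a , b , ℚ.- δ , δ , X.lo , X.up , -δ<y , y<δ , <ε X.0≤a , below X.a≤b , <ε X.0≤b , below ℚₚ.≤-refl)
  where
  module X = Between X
  0≤δ = ℚₚ.<⇒≤ 0<δ
  0<ε = ℚₚ.≤-<-trans (0≤* X.0≤b 0≤δ) bδ<ε
  below : ∀ {c} → c ℚ.≤ b → c ℚ.* δ ℚ.< ε
  below c≤b = ℚₚ.≤-<-trans (ℚₚ.*-monoʳ-≤-nonNeg δ {{ℚ.nonNegative 0≤δ}} c≤b) bδ<ε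
  above : ∀ {c} → c ℚ.≤ b → ℚ.- ε ℚ.< c ℚ.* ℚ.- δ
  above {c} c≤b = subst (ℚ.- ε ℚ.<_) (ℚₚ.neg-distribʳ-* c δ) (ℚₚ.neg-antimono-< (below c≤b))
  -ε< : ∀ {c} → 0ℚ ℚ.≤ c → ℚ.- ε ℚ.< c ℚ.* δ
  -ε< 0≤c = ℚₚ.<-≤-trans (ℚₚ.neg-antimono-< 0<ε) (0≤* 0≤c 0≤δ)
  <ε : ∀ {c} → 0ℚ ℚ.≤ c → c ℚ.* ℚ.- δ ℚ.< ε
  <ε {c} 0≤c = ℚₚ.≤-<-trans (subst (ℚ._≤ 0ℚ) (ℚₚ.neg-distribʳ-* c δ) (ℚₚ.neg-antimono-≤ (0≤* 0≤c 0≤δ))) 0<ε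

*ʳ-comm-lower : ∀ x y {q} → lower (x *ʳ y) q → lower (y *ʳ x) q
*ʳ-comm-lower x y {q} (a , b , c , d , a< , <b , c< , <d , ac , ad , bc , bd) =
  c , d , a , b , c< , <d , a< , <b , swap a c ac , swap b c bc , swap a d ad , swap b d bd
  where
  swap : ∀ a b → q ℚ.< a ℚ.* b → q ℚ.< b ℚ.* a
  swap a b = subst (q ℚ.<_) (ℚₚ.*-comm a b)

√0-Near0 : ∀ {δ} → 0ℚ ℚ.< δ → Near0 (√ (fromℕ 0)) δ
√0-Near0 0<δ = 0<δ , inj₁ (ℚₚ.neg-antimono-< 0<δ) , (0<δ , 0<* 0<δ 0<δ)

*-shrink : ∀ b w {ε} → 0ℚ ℚ.< ε → b ℚ.* w ℚ.< 1ℚ → b ℚ.* (ε ℚ.* w) ℚ.< ε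
*-shrink b w {ε} 0<ε bw<1 = subst₂ ℚ._<_
  (solve 3 (λ b w ε → ε :* (b :* w) := b :* (ε :* w)) refl b w ε) (ℚₚ.*-identityʳ ε)
  (ℚₚ.*-monoʳ-<-pos ε {{ℚ.positive 0<ε}} bw<1)
  where open ℚ-Solver.+-*-Solver

B*√0*4-lower : ∀ {ε} → 0ℚ ℚ.< ε → lower (B *ʳ √ (fromℕ 0) *ʳ fromℕ 4) (ℚ.- ε)
-- `*-Near0` expects the small factor on the right, so 4 is moved to the front. The weights 1/7000
-- and 1/6 beat the upper ends 6000 of B and 5 of 4.
B*√0*4-lower {ε} 0<ε = *ʳ-comm-lower (fromℕ 4) (B *ʳ √ (fromℕ 0))
  (proj₁ (proj₂ (*-Near0 (fromℕ-Between {4} {ι 3} {ι 5} eval-≤ eval-< eval-<)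
    (*-Near0 B-Between (√0-Near0 (0<* 0<δ eval-<)) (*-shrink (ι 6000) (ℤ.+ 1 ℚ./ 7000) 0<δ eval-<))
    (*-shrink (ι 5) (ℤ.+ 1 ℚ./ 6) 0<ε eval-<))))
  where
  0<δ : 0ℚ ℚ.< ε ℚ.* (ℤ.+ 1 ℚ./ 6)
  0<δ = 0<* 0<ε eval-<

ι-suc : ∀ n → ι (suc n) ≡ 1ℚ ℚ.+ ι n
ι-suc n = sym (trans
  (cong (1ℚ ℚ.+_) (ℚₚ.normalize-coprime (Coprime.sym (Coprime.1-coprimeTo n))))
  (cong (λ k → (1ℤ ℤ.+ k) ℚ./ 1) (ℤₚ.*-identityʳ (ℤ.+ n))))

0≤^ : ∀ {q} n → 0ℚ ℚ.≤ q → 0ℚ ℚ.≤ q ^ℚ n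
0≤^ zero    0≤q = eval-≤
0≤^ (suc n) 0≤q = 0≤* 0≤q (0≤^ n 0≤q)

-- Bernoulli's inequality for 1 / q, multiplied out so as not to divide.
bernoulli : ∀ {q} n → 0ℚ ℚ.≤ q → q ℚ.≤ 1ℚ →
  (q ^ℚ n) ℚ.* (1ℚ ℚ.+ ι n ℚ.* (1ℚ ℚ.- q)) ℚ.≤ 1ℚ
bernoulli {q} zero    0≤q q≤1 = ℚₚ.≤-reflexive
  (solve 1 (λ q → con 1ℚ :* (con 1ℚ :+ con 0ℚ :* (con 1ℚ :- q)) := con 1ℚ) refl q)
  where open ℚ-Solver.+-*-Solver
bernoulli {q} (suc n) 0≤q q≤1 = begin
  x                                          ≤⟨ ≤+ (0≤* (0≤^ n 0≤q) (0≤* (0≤ι (suc n)) (0≤* 0≤h 0≤h))) ⟩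
  x ℚ.+ (q ^ℚ n) ℚ.* (ι (suc n) ℚ.* (h ℚ.* h))  ≡⟨ identity ⟩
  (q ^ℚ n) ℚ.* (1ℚ ℚ.+ ι n ℚ.* h)            ≤⟨ bernoulli n 0≤q q≤1 ⟩
  1ℚ                                         ∎
  where
  open ℚₚ.≤-Reasoning
  open ℚ-Solver.+-*-Solver
  h x : ℚ
  h = 1ℚ ℚ.- q
  x = (q ^ℚ suc n) ℚ.* (1ℚ ℚ.+ ι (suc n) ℚ.* h)
  0≤h : 0ℚ ℚ.≤ h
  0≤h = subst (ℚ._≤ h) (ℚₚ.+-inverseʳ q) (ℚₚ.+-monoˡ-≤ (ℚ.- q) q≤1)
  identity : x ℚ.+ (q ^ℚ n) ℚ.* (ι (suc n) ℚ.* (h ℚ.* h)) ≡ (q ^ℚ n) ℚ.* (1ℚ ℚ.+ ι n ℚ.* h)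
  identity rewrite ι-suc n = solve 3 (λ q p k →
      (q :* p) :* (con 1ℚ :+ (con 1ℚ :+ k) :* (con 1ℚ :- q)) :+
        p :* ((con 1ℚ :+ k) :* ((con 1ℚ :- q) :* (con 1ℚ :- q))) :=
      p :* (con 1ℚ :+ k :* (con 1ℚ :- q)))
    refl q (q ^ℚ n) (ι n)

-- The multiplier is the denominator of p: the product is then the numerator, a positive integer.
archimedean : ∀ {p} → 0ℚ ℚ.< p → ∃[ d ] 1ℚ ℚ.≤ ι (suc d) ℚ.* p
archimedean {p} 0<p = bound p (ℚ.positive 0<p)
  where
  bound : ∀ p → ℚ.Positive p → ∃[ d ] 1ℚ ℚ.≤ ι (suc d) ℚ.* p
  bound p@(mkℚ +[1+ a ] d-1 _) _ = d-1 , subst (1ℚ ℚ.≤_)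
    (trans (sym (a/d*d≡a (suc a) (suc d-1)))
      (trans (cong (ℚ._* ι (suc d-1)) (ℚₚ.fromℚᵘ-toℚᵘ p)) (ℚₚ.*-comm p (ι (suc d-1)))))
    (ι-mono-≤ {1} {suc a} (s≤s z≤n))

p*x≤1⇒p<½ : ∀ {p x} → 0ℚ ℚ.≤ p → ι 3 ℚ.≤ x → p ℚ.* x ℚ.≤ 1ℚ → p ℚ.< ½
p*x≤1⇒p<½ {p} {x} 0≤p 3≤x px≤1 = ℚₚ.≤-<-trans
  (ℚₚ.*-cancelʳ-≤-pos {p} {ℤ.+ 1 ℚ./ 3} (ι 3)
    (ℚₚ.≤-trans (ℚₚ.*-monoˡ-≤-nonNeg p {{ℚ.nonNegative 0≤p}} 3≤x) px≤1))
  eval-<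

-- If (d + 1)(1 - q) ≥ 1, the power N = 2 (d + 1) makes the Bernoulli factor at least 3, so q^N ≤
-- 1/3. Without the doubling only q^N ≤ 1/2 would follow.
^<½ : ∀ {q} → 0ℚ ℚ.≤ q → q ℚ.< 1ℚ → ∃[ n ] (q ^ℚ suc n) ℚ.< ½
^<½ {q} 0≤q q<1 = from (archimedean 0<h)
  where
  h : ℚ
  h = 1ℚ ℚ.- q
  0<h : 0ℚ ℚ.< h
  0<h = subst (ℚ._< h) (ℚₚ.+-inverseʳ q) (ℚₚ.+-monoˡ-< (ℚ.- q) q<1)
  double : ∀ d p → 1ℚ ℚ.≤ ι (suc d) ℚ.* p → ι 2 ℚ.≤ ι (2 * suc d) ℚ.* p
  double d p 1≤dp = subst (ι 2 ℚ.≤_)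
    (trans (sym (ℚₚ.*-assoc (ι 2) (ι (suc d)) p)) (cong (ℚ._* p) (sym (ι-homo-* 2 (suc d)))))
    (ℚₚ.*-monoˡ-≤-nonNeg (ι 2) 1≤dp)
  from : ∃[ d ] 1ℚ ℚ.≤ ι (suc d) ℚ.* h → ∃[ n ] (q ^ℚ suc n) ℚ.< ½
  from (d , 1≤dh) = pred (2 * suc d) , p*x≤1⇒p<½ (0≤^ (2 * suc d) 0≤q)
    (ℚₚ.+-monoʳ-≤ 1ℚ (double d h 1≤dh)) (bernoulli (2 * suc d) 0≤q (ℚₚ.<⇒≤ q<1))

-- The form `mkℚ` lets numerator and denominator of the exponent compute, so that comparing q with
-- the root of 1/2 becomes the hypothesis.
<2^-1/ : ∀ {q} n → (q ^ℚ suc n) ℚ.< ½ → q <2^ (ℚ.- mkℚ (ℤ.+ 1) n (Coprime.1-coprimeTo (suc n)))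
<2^-1/ n q^n<½ = inj₂ q^n<½

-- A positive q < 1 has a power below 1/2, hence q < 2^(-1/(n + 1)) for some n, and this exponent
-- lies below x.
lower-2^-0 : ∀ x {q} → (∀ {ε} → 0ℚ ℚ.< ε → lower x (ℚ.- ε)) → q ℚ.< 1ℚ → lower (2^ʳ x) q
lower-2^-0 x {q} x>-ε q<1 = Sum.[ q≤0 , q>0 ]′ (ℚₚ.≤-total q 0ℚ)
  where
  q≤0 : q ℚ.≤ 0ℚ → lower (2^ʳ x) q
  q≤0 q≤0 = ℚ.- 1ℚ , x>-ε {1ℚ} eval-< , inj₁ q≤0
  root : ∃[ n ] (q ^ℚ suc n) ℚ.< ½ → lower (2^ʳ x) q
  root (n , q^n<½) = ℚ.- 1/1+n , x>-ε {1/1+n} (ℚₚ.positive⁻¹ 1/1+n) , <2^-1/ n q^n<½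
    where
    1/1+n : ℚ
    1/1+n = mkℚ (ℤ.+ 1) n (Coprime.1-coprimeTo (suc n))
  q>0 : 0ℚ ℚ.≤ q → lower (2^ʳ x) q
  q>0 0≤q = root (^<½ 0≤q q<1)

lower-2^-ι : ∀ x M {q} → lower x (ι M) → q ℚ.< ι (2 ^ M) → lower (2^ʳ x) q
lower-2^-ι x M {q} M<x q<2^M = ι M , M<x , q<2^ι
  where
  M/1 : ℚ
  M/1 = mkℚ (ℤ.+ M) 0 (Coprime.sym (Coprime.1-coprimeTo M))
  q<2^ι : q <2^ ι M
  -- For a variable M the fraction `ι M` does not reduce; its coprime form exposes the denominator
  -- 1.
  q<2^ι = subst (q <2^_) (sym (ℚₚ.normalize-coprime (Coprime.sym (Coprime.1-coprimeTo M))))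
    (inj₂ (subst₂ ℚ._<_ (sym (ℚₚ.*-identityʳ q)) (ι-^ 2 M) q<2^M))

-- Put c = 10 M / T, so that c < √n by the hypothesis. With B > 1/2 weakened to 1/4 and T to T/2 for
-- strictness, the product exceeds (c/4)(T/2) = 10 M / 8 > M.
B*√n*T-lower : ∀ M n T .{{_ : NonZero T}} → 1 ≤ M →
  (10 * M) * (10 * M) < n * (T * T) →
  lower (B *ʳ √ (fromℕ n) *ʳ fromℕ T) (ι M)
B*√n*T-lower M n T 1≤M M²<nT² = *-lower B√n fromT below
  where
  c : ℚ
  c = ℤ.+ (10 * M) ℚ./ T
  0<T : 0ℚ ℚ.< ι T
  0<T = ι-mono-< {0} {T} (>-nonZero⁻¹ T)
  0<M : 0ℚ ℚ.< ι M
  0<M = ι-mono-< {0} {M} 1≤M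
  instance
    T-pos : ℚ.Positive (ι T)
    T-pos = ℚ.positive 0<T
    T-nonNeg : ℚ.NonNegative (ι T)
    T-nonNeg = ℚₚ.pos⇒nonNeg (ι T)
  cT : c ℚ.* ι T ≡ ι (10 * M)
  cT = a/d*d≡a (10 * M) T
  0<c : 0ℚ ℚ.< c
  0<c = ℚₚ.*-cancelʳ-<-nonNeg (ι T) (subst₂ ℚ._<_ (sym (ℚₚ.*-zeroˡ (ι T))) (sym cT)
    (ι-mono-< {0} {10 * M} (*-mono-≤ {1} {10} (s≤s z≤n) 1≤M)))
  c²<n : c ℚ.* c ℚ.< ι n
  c²<n = ℚₚ.*-cancelʳ-<-nonNeg (ι T) (ℚₚ.*-cancelʳ-<-nonNeg (ι T) (begin-strict
    c ℚ.* c ℚ.* ι T ℚ.* ι T       ≡⟨ solve 2 (λ c t → c :* c :* t :* t := (c :* t) :* (c :* t)) refl c (ι T) ⟩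
    c ℚ.* ι T ℚ.* (c ℚ.* ι T)     ≡⟨ cong₂ ℚ._*_ cT cT ⟩
    ι (10 * M) ℚ.* ι (10 * M) ≡⟨ ι-homo-* (10 * M) (10 * M) ⟨
    ι (10 * M * (10 * M))   <⟨ ι-mono-< M²<nT² ⟩
    ι (n * (T * T))           ≡⟨ ι-homo-* n (T * T) ⟩
    ι n ℚ.* ι (T * T)           ≡⟨ cong (ι n ℚ.*_) (ι-homo-* T T) ⟩
    ι n ℚ.* (ι T ℚ.* ι T)         ≡⟨ ℚₚ.*-assoc (ι n) (ι T) (ι T) ⟨
    ι n ℚ.* ι T ℚ.* ι T           ∎))
    where
    open ℚₚ.≤-Reasoning
    open ℚ-Solver.+-*-Solver
  d : ℚ
  -- A crude upper bound on √n, needed only to complete the enclosure.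
  d = ι (suc n)
  n<d² : ι n ℚ.< d ℚ.* d
  n<d² = subst (ι n ℚ.<_) (ι-homo-* (suc n) (suc n)) (ι-mono-< {n} {suc n * suc n} (m≤m*n (suc n) (suc n)))
  c≤d : c ℚ.≤ d
  c≤d = ℚₚ.≮⇒≥ λ d<c → ℚₚ.<-asym (ℚₚ.<-trans c²<n n<d²)
    (ℚₚ.≤-<-trans (ℚₚ.*-monoʳ-≤-nonNeg d {{ℚ.nonNegative (0≤ι (suc n))}} (ℚₚ.<⇒≤ d<c))
      (ℚₚ.*-monoʳ-<-pos c {{ℚ.positive 0<c}} d<c))
  √n : Between (√ (fromℕ n)) c d
  √n = √-Between {fromℕ n} (ℚₚ.<⇒≤ 0<c) c≤d (ι-mono-< {0} {suc n} (s≤s z≤n)) c²<n n<d²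
  B√n : Between (B *ʳ √ (fromℕ n)) (ℤ.+ 1 ℚ./ 4 ℚ.* c) (ι 6000 ℚ.* d ℚ.+ 1ℚ)
  B√n = *-Between B-Between √n (0≤* {ℤ.+ 1 ℚ./ 4} eval-≤ (ℚₚ.<⇒≤ 0<c))
    (ℚₚ.*-monoˡ-<-pos c {{ℚ.positive 0<c}} {ℤ.+ 1 ℚ./ 4} {½} eval-<)
    (subst (ℚ._< ι 6000 ℚ.* d ℚ.+ 1ℚ) (ℚₚ.+-identityʳ _) (ℚₚ.+-monoʳ-< (ι 6000 ℚ.* d) {0ℚ} {1ℚ} eval-<))
  fromT : Between (fromℕ T) (½ ℚ.* ι T) (ι (suc T))
  fromT = fromℕ-Between {T} (0≤* {½} eval-≤ (ℚₚ.<⇒≤ 0<T))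
    (subst (½ ℚ.* ι T ℚ.<_) (ℚₚ.*-identityˡ (ι T)) (ℚₚ.*-monoˡ-<-pos (ι T) {½} {1ℚ} eval-<))
    (ι-mono-< (n<1+n T))
  below : ι M ℚ.< (ℤ.+ 1 ℚ./ 4 ℚ.* c) ℚ.* (½ ℚ.* ι T)
  below = begin-strict
    ι M                                ≡⟨ ℚₚ.*-identityˡ (ι M) ⟨
    1ℚ ℚ.* ι M                         <⟨ ℚₚ.*-monoˡ-<-pos (ι M) {{ℚ.positive 0<M}} {1ℚ} {ℤ.+ 1 ℚ./ 4 ℚ.* ½ ℚ.* ι 10} eval-< ⟩
    ℤ.+ 1 ℚ./ 4 ℚ.* ½ ℚ.* ι 10 ℚ.* ι M   ≡⟨ ℚₚ.*-assoc (ℤ.+ 1 ℚ./ 4 ℚ.* ½) (ι 10) (ι M) ⟩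
    ℤ.+ 1 ℚ./ 4 ℚ.* ½ ℚ.* (ι 10 ℚ.* ι M) ≡⟨ cong (ℤ.+ 1 ℚ./ 4 ℚ.* ½ ℚ.*_) (trans (sym (ι-homo-* 10 M)) (sym cT)) ⟩
    ℤ.+ 1 ℚ./ 4 ℚ.* ½ ℚ.* (c ℚ.* ι T)    ≡⟨ solve 4 (λ u v c t → u :* v :* (c :* t) := u :* c :* (v :* t)) refl (ℤ.+ 1 ℚ./ 4) ½ c (ι T) ⟩
    ℤ.+ 1 ℚ./ 4 ℚ.* c ℚ.* (½ ℚ.* ι T)    ∎
    where
    open ℚₚ.≤-Reasoning
    open ℚ-Solver.+-*-Solver

theorem6p2 : (k : ℕ) → 1 ≤ k → ∃[ R ] (IsRamseyNumber 3 k R × fromℕ R ≤ʳ 2^ʳ (B *ʳ √ (fromℕ (k ∸ 1)) *ʳ fromℕ (2 ^ (2 * k))))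
theorem6p2 (suc zero) _ =
  let R , isR , R≤1 = ramseyNumber 3 1 1 ramseyProperty-1 in
  R , isR , λ q q<R →
    -- The exponent is 0 here, so the right side is 1, and R ≤ 1.
    lower-2^-0 (B *ʳ √ (fromℕ 0) *ʳ fromℕ 4) B*√0*4-lower (ℚₚ.<-≤-trans q<R (ι-mono-≤ R≤1))
theorem6p2 (suc (suc m)) _ =
  -- `central m` unfolds to `suc (slots m m)`, so `exponent m` is the exponent that the game
  -- produces.
  let R , isR , R≤2^M = ramseyNumber 3 (2 + m) (2 ^ exponent m) (ramseyProperty-2^ m) in
  R , isR , λ q q<R →
    lower-2^-ι (B *ʳ √ (fromℕ (suc m)) *ʳ fromℕ (2 ^ (2 * (2 + m)))) (exponent m)
      (B*√n*T-lower (exponent m) (suc m) (2 ^ (2 * (2 + m))) {{m^n≢0 2 (2 * (2 + m))}}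
        (exponent>0 m) (exponent-bound m))
      (ℚₚ.<-≤-trans q<R (ι-mono-≤ R≤2^M))
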